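{- Let $A\subseteq\mathbb{N}$ and let $f:\mathbb{N}^3\to\mathbb{N}$ be defined by $f(m,n_1,n_2)=n_1$ if $m\in A$ and $f(m,n_1,n_2)=n_2$ otherwise. Then either $f$ is not strictly definable, or $f\in\mathcal{G}$.
   Context: We work in the simply typed $\lambda$-calculus (type assignment to untyped $\lambda$-terms) with a single base type $o$, with $\beta\eta$-conversion as equality. For a type $\tau$, $\omega_\tau=(\tau\to\tau)\to\tau\to\tau$. The Church numeral of $n$ is $\rho(n)=\lambda f x.f^{n}x$. A function $f:\mathbb{N}^k\to\mathbb{N}$ is strictly definable if there exist a type $\tau$ and a term $E$ with $\vdash E:\omega_\tau\to\cdots\to\omega_\tau\to\omega_\tau$ ($k$ arguments) such that $E\,\rho(n_1)\cdots\rho(n_k)=_{\beta\eta}\rho(f(n_1,\dots,n_k))$ for all $n_1,\dots,n_k$. Extended polynomials: the smallest class of functions over $\mathbb{N}$ containing the constants $0$ and $1$, projections, addition, multiplication and $\mathrm{ifzero}(n,m,p)=(\text{if } n=0 \text{ then } m \text{ else } p)$, closed under composition. $\mathcal{G}$ is the smallest class of functions over $\mathbb{N}$ that is closed under composition and contains: all extended polynomials; for every $l\geq 2$ the function $f_1^{l}(m,n_1,\dots,n_l)=n_i$ where $i=(m\bmod l)+1$; and for every $l\geq 1$ the function $f_2^{l}(m,n_1,n_2)=(\text{if } m\leq l \text{ then } n_1 \text{ else } n_2)$. -}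

module Defs where

open import Data.Bool.Base using (if_then_else_)
open import Data.Fin.Base using (Fin; zero; suc)
open import Data.Nat.Base using (ℕ; zero; suc; _+_; _*_; _≤_; _≤ᵇ_; NonZero)
open import Data.Nat.DivMod using (_mod_)
open import Data.Product.Base using (Σ-syntax; _×_)
open import Data.Vec.Base using (Vec; []; _∷_; lookup; map; tabulate)
open import Relation.Binary.Construct.Closure.Equivalence using (EqClosure)
open import Relation.Binary.PropositionalEquality.Core using (_≡_; _≗_)
open import Relation.Unary using (Pred; _∈_; _∉_)

-- Untyped λ-terms with at most n free variables (de Bruijn indices).

data Term (n : ℕ) : Set where
  var : Fin n → Term n
  lam : Term (suc n) → Term n
  app : Term n → Term n → Term n

liftRen : ∀ {m n} → (Fin m → Fin n) → Fin (suc m) → Fin (suc n)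
liftRen r zero    = zero
liftRen r (suc i) = suc (r i)

rename : ∀ {m n} → (Fin m → Fin n) → Term m → Term n
rename r (var i)   = var (r i)
rename r (lam M)   = lam (rename (liftRen r) M)
rename r (app M N) = app (rename r M) (rename r N)

weaken : ∀ {n} → Term n → Term (suc n)
weaken = rename suc

liftSub : ∀ {m n} → (Fin m → Term n) → Fin (suc m) → Term (suc n)
liftSub s zero    = var zero
liftSub s (suc i) = weaken (s i)

subst : ∀ {m n} → (Fin m → Term n) → Term m → Term n
subst s (var i)   = s i
subst s (lam M)   = lam (subst (liftSub s) M)
subst s (app M N) = app (subst s M) (subst s N)

single : ∀ {n} → Term n → Fin (suc n) → Term n
single N zero    = N
single N (suc i) = var i

infix 25 _[_]

_[_] : ∀ {n} → Term (suc n) → Term n → Term n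
M [ N ] = subst (single N) M

infix 4 _⟶_ _=βη_

data _⟶_ {n : ℕ} : Term n → Term n → Set where
  β    : ∀ {M N} → app (lam M) N ⟶ M [ N ]
  η    : ∀ {M} → lam (app (weaken M) (var zero)) ⟶ M
  ξ    : ∀ {M M′ : Term (suc n)} → M ⟶ M′ → lam M ⟶ lam M′
  appˡ : ∀ {M M′ N} → M ⟶ M′ → app M N ⟶ app M′ N
  appʳ : ∀ {M N N′} → N ⟶ N′ → app M N ⟶ app M N′

_=βη_ : ∀ {n} → Term n → Term n → Set
_=βη_ = EqClosure _⟶_

infixr 20 _⇒_

data Type : Set where
  o   : Type
  _⇒_ : Type → Type → Type

infix 4 _⊢_∶_

data _⊢_∶_ {n : ℕ} (Γ : Vec Type n) : Term n → Type → Set where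
  ⊢var : ∀ {i} → Γ ⊢ var i ∶ lookup Γ i
  ⊢lam : ∀ {M σ τ} → σ ∷ Γ ⊢ M ∶ τ → Γ ⊢ lam M ∶ σ ⇒ τ
  ⊢app : ∀ {M N σ τ} → Γ ⊢ M ∶ σ ⇒ τ → Γ ⊢ N ∶ σ → Γ ⊢ app M N ∶ τ

ω : Type → Type
ω τ = (τ ⇒ τ) ⇒ τ ⇒ τ

-- ω τ ⇒ ⋯ ⇒ ω τ ⇒ ω τ with k arguments.
ωFun : ℕ → Type → Type
ωFun zero    τ = ω τ
ωFun (suc k) τ = ω τ ⇒ ωFun k τ

iterApp : ∀ {n} → ℕ → Term n → Term n → Term n
iterApp zero    F X = X
iterApp (suc k) F X = app F (iterApp k F X)

ρ : ℕ → Term 0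
ρ n = lam (lam (iterApp n (var (suc zero)) (var zero)))

-- Left-associated application to a sequence of arguments.
appAll : ∀ {n k} → Term n → Vec (Term n) k → Term n
appAll M []       = M
appAll M (N ∷ Ns) = appAll (app M N) Ns

Op : ℕ → Set
Op k = Vec ℕ k → ℕ

StrictlyDefinable : ∀ {k} → Op k → Set
StrictlyDefinable {k} f =
  Σ[ τ ∈ Type ] Σ[ E ∈ Term 0 ]
    ([] ⊢ E ∶ ωFun k τ) ×
    (∀ (ns : Vec ℕ k) → appAll E (map ρ ns) =βη ρ (f ns))

-- The smallest class of functions containing B and closed under
-- composition.  `resp` is needed because functions are identified
-- extensionally, and pointwise equality does not imply _≡_ here.

data Closure (B : ∀ {k} → Op k → Set) : ∀ {k} → Op k → Set where
  base : ∀ {k} {f : Op k} → B f → Closure B f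
  comp : ∀ {j k} {g : Op j} {hs : Fin j → Op k} →
         Closure B g → (∀ i → Closure B (hs i)) →
         Closure B (λ ns → g (tabulate (λ i → hs i ns)))
  resp : ∀ {k} {f g : Op k} → f ≗ g → Closure B f → Closure B g

add mul : Op 2
add (m ∷ n ∷ []) = m + n
mul (m ∷ n ∷ []) = m * n

ifzero : Op 3
ifzero (zero  ∷ m ∷ p ∷ []) = m
ifzero (suc _ ∷ m ∷ p ∷ []) = p

data ExtPolyBase : ∀ {k} → Op k → Set where
  isConst0 : ∀ {k} → ExtPolyBase {k} (λ _ → 0)
  isConst1 : ∀ {k} → ExtPolyBase {k} (λ _ → 1)
  isProj   : ∀ {k} (i : Fin k) → ExtPolyBase (λ ns → lookup ns i)
  isAdd    : ExtPolyBase add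
  isMul    : ExtPolyBase mul
  isIfzero : ExtPolyBase ifzero

ExtPoly : ∀ {k} → Op k → Set
ExtPoly = Closure ExtPolyBase

-- `lookup` counts from 0, so the index is m mod l, not (m mod l) + 1.
f₁ : ∀ l .{{_ : NonZero l}} → Op (suc l)
f₁ l (m ∷ ns) = lookup ns (m mod l)

f₂ : ℕ → Op 3
f₂ l (m ∷ n₁ ∷ n₂ ∷ []) = if m ≤ᵇ l then n₁ else n₂

data GBase : ∀ {k} → Op k → Set where
  isExtPoly : ∀ {k} {f : Op k} → ExtPoly f → GBase f
  isF₁      : ∀ l .{{_ : NonZero l}} → 2 ≤ l → GBase (f₁ l)
  isF₂      : ∀ l → 1 ≤ l → GBase (f₂ l)

𝒢 : ∀ {k} → Op k → Set
𝒢 = Closure GBase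

-- The definition of f by cases on membership in A.  It is a relation
-- because, A being an arbitrary predicate, f cannot be computed from A.
record IsCaseFunction {a} (A : Pred ℕ a) (f : Op 3) : Set a where
  field
    inside  : ∀ m n₁ n₂ → m ∈ A → f (m ∷ n₁ ∷ n₂ ∷ []) ≡ n₁
    outside : ∀ m n₁ n₂ → m ∉ A → f (m ∷ n₁ ∷ n₂ ∷ []) ≡ n₂

{-# OPTIONS --safe #-}
-- Interpret types as finite sets, with o ↦ {0, 1}.  The values of the Church
-- numerals are the orbit of one point under a self-map of a finite set, hence
-- eventually periodic; numerals with the same value cannot be told apart by a
-- typed term E, so A is eventually periodic, and case distinction on such a set
-- is composed from f₁ˡ and f₂ˡ.
--
-- A βη-conversion between typed terms may pass through untypable ones, on which
-- the finite model says nothing.  Instead of confluence and subject reduction,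
-- untyped terms are interpreted in an extensional filter model, and a logical
-- relation ties upward closed subsets of that model to the finite values.  The
-- relation transports the value of E ρ(m) ρ(1) ρ(0) to its βη-equal numeral,
-- and no value is related to both ρ(0) and ρ(1).
module Submission where

open import Defs
open import Axiom.ExcludedMiddle using (ExcludedMiddle)
open import Data.Bool.Base using (true; false)
open import Data.Empty using (⊥; ⊥-elim)
open import Data.Fin.Base using (Fin; zero; suc; toℕ; finToFun; funToFin)
open import Data.Fin.Properties using (finToFun-funToFin; pigeonhole; toℕ-fromℕ<)
open import Data.List.Base using (List; []; _∷_; [_]; _++_)
open import Data.List.Relation.Unary.All as All using (All; []; _∷_)
open import Data.List.Relation.Unary.All.Properties as All using ()
open import Data.List.Relation.Unary.Any using (Any; here; there)
open import Data.List.Relation.Unary.Any.Properties using (++⁺ˡ; ++⁺ʳ)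
open import Data.Nat.Base using (ℕ; zero; suc; _+_; _*_; _≤ᵇ_; _^_; _≤_; z≤n; s≤s; NonZero)
open import Data.Nat.DivMod using (_%_; _/_; _mod_; m≡m%n+[m/n]*n; [m+kn]%n≡m%n; m%n<n)
open import Data.Nat.Properties as ℕ using (_≟_)
open import Data.Nat.Tactic.RingSolver using (solve-∀)
open import Data.Product.Base using (_×_; _,_; proj₁; proj₂; ∃; ∃₂)
open import Data.Sum.Base using (_⊎_; inj₁; inj₂)
open import Data.Unit.Base using (tt)
open import Data.Vec.Base as Vec using (Vec; []; _∷_)
open import Data.Vec.Properties using (lookup∘tabulate)
open import Function.Base using (_∘_; id)
open import Level using (0ℓ; Lift; lift)
open import Relation.Binary.Construct.Closure.ReflexiveTransitive using (ε; _◅_)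
open import Relation.Binary.Construct.Closure.Symmetric using (fwd; bwd)
open import Relation.Binary.PropositionalEquality as ≡ using (_≡_; refl)
open import Relation.Nullary.Decidable.Core using (Dec; yes; no; decidable-stable; ¬¬-excluded-middle)
open import Relation.Nullary.Negation.Core using (¬_; contradiction)
open import Relation.Nullary.Reflects using (ofʸ; ofⁿ)
open import Relation.Unary using (Pred; _⊆_; _≐_; ∅; U)
open import Relation.Unary.Properties using (≐-refl; ≐-sym; ≐-trans)

-- Intersection types and their subtyping order.

infixr 6 _↦_

-- Intersection types: a₁ ∧ ⋯ ∧ aₖ → t is written (a₁ ∷ ⋯ ∷ aₖ ∷ []) ↦ t.
data D : Set where
  ⋆   : D
  _↦_ : List D → D → D

-- ⋆ is identified with [] ↦ ⋆, so that every element is an arrow; this is what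
-- makes η valid.
args : D → List D
args ⋆       = []
args (a ↦ t) = a

res : D → D
res ⋆       = ⋆
res (a ↦ t) = t

infix 4 _⊑_

-- Subtyping, contravariant in the arguments: whatever has type `s` also has type `t`. The axiom
-- `⋆⊑⋆` starts the recursion, since `arr` at `⋆` would ask for `⋆ ⊑ ⋆` again.
data _⊑_ : D → D → Set where
  ⋆⊑⋆ : ⋆ ⊑ ⋆
  arr : ∀ {s t} → All (λ r → Any (_⊑ r) (args t)) (args s) → res s ⊑ res t → s ⊑ t

↑ : List D → Pred D 0ℓ
↑ a s = Any (_⊑ s) a

mutual
  ⊑-refl : ∀ t → t ⊑ t
  ⊑-refl ⋆       = ⋆⊑⋆
  ⊑-refl (a ↦ t) = arr (⊆-↑ a) (⊑-refl t)

  ⊆-↑ : ∀ a → All (↑ a) a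
  ⊆-↑ []      = []
  ⊆-↑ (t ∷ a) = here (⊑-refl t) ∷ All.map there (⊆-↑ a)

mutual
  ⊑-trans : ∀ {s t u} → s ⊑ t → t ⊑ u → s ⊑ u
  ⊑-trans ⋆⊑⋆       q         = q
  ⊑-trans (arr p q) ⋆⊑⋆       = arr p q
  ⊑-trans (arr p q) (arr r s) = arr (⊑-transᴬ p r) (⊑-trans q s)

  ⊑-transᴬ : ∀ {a b c} → All (↑ b) a → All (↑ c) b → All (↑ c) a
  ⊑-transᴬ []       r = []
  ⊑-transᴬ (p ∷ ps) r = ⊑-transᴱ p r ∷ ⊑-transᴬ ps r

  ⊑-transᴱ : ∀ {b c s} → ↑ b s → All (↑ c) b → ↑ c s
  ⊑-transᴱ (here p)  (r ∷ rs) = ⊑-transᴱ′ r p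
  ⊑-transᴱ (there p) (r ∷ rs) = ⊑-transᴱ p rs

  ⊑-transᴱ′ : ∀ {c s t} → ↑ c t → t ⊑ s → ↑ c s
  ⊑-transᴱ′ (here r)  p = here (⊑-trans r p)
  ⊑-transᴱ′ (there r) p = there (⊑-transᴱ′ r p)

-- Upward closed sets as elements of the filter model.

Upward : Pred D 0ℓ → Set
Upward P = ∀ {s t} → s ⊑ t → P s → P t

↑-upward : ∀ a → Upward (↑ a)
↑-upward a p q = ⊑-transᴱ′ q p

↑-least : ∀ {a P} → Upward P → All P a → ↑ a ⊆ P
↑-least up (x ∷ xs) (here p)  = up p x
↑-least up (x ∷ xs) (there p) = ↑-least up xs p

infixl 8 _·_

_·_ : Pred D 0ℓ → Pred D 0ℓ → Pred D 0ℓ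
(P · Q) t = ∃ λ a → P (a ↦ t) × All Q a

·-mono : ∀ {P P′ Q Q′} → P ⊆ P′ → Q ⊆ Q′ → P · Q ⊆ P′ · Q′
·-mono P⊆ Q⊆ (a , p , q) = a , P⊆ p , All.map Q⊆ q

·-cong : ∀ {P P′ Q Q′} → P ≐ P′ → Q ≐ Q′ → P · Q ≐ P′ · Q′
·-cong {P} {P′} (p , p′) (q , q′) = ·-mono {P} p q , ·-mono {P′} p′ q′

·-upward : ∀ {P Q} → Upward P → Upward (P · Q)
·-upward up p (a , m , n) = a , up (arr (⊆-↑ a) p) m , n

-- Interpretation of untyped terms.

Env : ℕ → Set₁
Env n = Fin n → Pred D 0ℓ

infixr 5 _▸_

_▸_ : ∀ {n} → Pred D 0ℓ → Env n → Env (suc n)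
(P ▸ e) zero    = P
(P ▸ e) (suc i) = e i

-- This is type inference: in the `lam` clause every `d` is read as an arrow, and the bound variable
-- gets exactly the types that follow from `args d`.
⟦_⟧ : ∀ {n} → Term n → Env n → Pred D 0ℓ
⟦ var i ⟧   e   = e i
⟦ lam M ⟧   e d = ⟦ M ⟧ (↑ (args d) ▸ e) (res d)
⟦ app M N ⟧ e   = ⟦ M ⟧ e · ⟦ N ⟧ e

▸-mono : ∀ {n} {P Q} {e e′ : Env n} → P ⊆ Q → (∀ i → e i ⊆ e′ i) →
         ∀ i → (P ▸ e) i ⊆ (Q ▸ e′) i
▸-mono p q zero    = p
▸-mono p q (suc i) = q i

▸-upward : ∀ {n P} {e : Env n} → Upward P → (∀ i → Upward (e i)) → ∀ i → Upward ((P ▸ e) i)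
▸-upward p q zero    = p
▸-upward p q (suc i) = q i

⟦⟧-mono : ∀ {n} (M : Term n) {e e′} → (∀ i → e i ⊆ e′ i) → ⟦ M ⟧ e ⊆ ⟦ M ⟧ e′
⟦⟧-mono (var i)   e⊆ = e⊆ i
⟦⟧-mono (lam M)   e⊆ = ⟦⟧-mono M (▸-mono id e⊆)
⟦⟧-mono (app M N) {e} e⊆ = ·-mono {⟦ M ⟧ e} (⟦⟧-mono M e⊆) (⟦⟧-mono N e⊆)

⟦⟧-cong : ∀ {n} (M : Term n) {e e′} → (∀ i → e i ≐ e′ i) → ⟦ M ⟧ e ≐ ⟦ M ⟧ e′
⟦⟧-cong M e≐ = ⟦⟧-mono M (proj₁ ∘ e≐) , ⟦⟧-mono M (proj₂ ∘ e≐)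

⟦⟧-upward : ∀ {n} (M : Term n) {e} → (∀ i → Upward (e i)) → Upward (⟦ M ⟧ e)
⟦⟧-upward (var i)   up p = up i p
⟦⟧-upward (lam M)   up ⋆⊑⋆       m = m
-- By contravariance `args t` generates a larger upward closed set than `args s`, so the environment
-- of the body grows.
⟦⟧-upward (lam M)   up (arr {s} {t} p q) m =
  ⟦⟧-mono M (▸-mono (↑-least (↑-upward (args t)) p) (λ _ → id))
    (⟦⟧-upward M (▸-upward (↑-upward (args s)) up) q m)
⟦⟧-upward (app M N) up = ·-upward {P = ⟦ M ⟧ _} (⟦⟧-upward M up)

⟦rename⟧ : ∀ {m n} (r : Fin m → Fin n) (M : Term m) e → ⟦ rename r M ⟧ e ≐ ⟦ M ⟧ (e ∘ r)
⟦rename⟧ r (var i)   e = ≐-refl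
⟦rename⟧ r (lam M)   e = (λ {d} → proj₁ (eq d)) , (λ {d} → proj₂ (eq d))
  where
  lifted : ∀ {P} i → (P ▸ e) (liftRen r i) ≐ (P ▸ e ∘ r) i
  lifted zero    = ≐-refl
  lifted (suc i) = ≐-refl
  eq : ∀ d → ⟦ rename (liftRen r) M ⟧ (↑ (args d) ▸ e) ≐ ⟦ M ⟧ (↑ (args d) ▸ e ∘ r)
  eq d = ≐-trans (⟦rename⟧ (liftRen r) M _) (⟦⟧-cong M lifted)
⟦rename⟧ r (app M N) e = ·-cong (⟦rename⟧ r M e) (⟦rename⟧ r N e)

⟦subst⟧ : ∀ {m n} (s : Fin m → Term n) (M : Term m) e →
          ⟦ subst s M ⟧ e ≐ ⟦ M ⟧ (λ i → ⟦ s i ⟧ e)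
⟦subst⟧ s (var i)   e = ≐-refl
⟦subst⟧ s (lam M)   e = (λ {d} → proj₁ (eq d)) , (λ {d} → proj₂ (eq d))
  where
  lifted : ∀ {P} i → ⟦ liftSub s i ⟧ (P ▸ e) ≐ (P ▸ λ j → ⟦ s j ⟧ e) i
  lifted zero    = ≐-refl
  lifted (suc i) = ⟦rename⟧ suc (s i) _
  eq : ∀ d → ⟦ subst (liftSub s) M ⟧ (↑ (args d) ▸ e) ≐ ⟦ M ⟧ (↑ (args d) ▸ λ i → ⟦ s i ⟧ e)
  eq d = ≐-trans (⟦subst⟧ (liftSub s) M _) (⟦⟧-cong M lifted)
⟦subst⟧ s (app M N) e = ·-cong (⟦subst⟧ s M e) (⟦subst⟧ s N e)

-- Continuity, and soundness of the interpretation for βη.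

record Approx {n} (e : Env n) (F : Env n → Set) : Set where
  constructor approx
  field
    parts : Fin n → List D
    below : ∀ i → All (e i) (parts i)
    holds : F (↑ ∘ parts)

Continuous : ∀ {n} → (Env n → Set) → Set₁
Continuous F = ∀ e → F e → Approx e F

singleton : ∀ {n} {e : Env n} i {t} → e i t → Approx e (λ e′ → e′ i t)
singleton {e = e} i {t} p = approx (pts i) (bel i p) (hol i)
  where
  pts : ∀ {n} → Fin n → Fin n → List D
  pts zero    zero    = [ t ]
  pts zero    (suc j) = []
  pts (suc i) zero    = []
  pts (suc i) (suc j) = pts i j
  bel : ∀ {n} {e : Env n} i → e i t → ∀ j → All (e j) (pts i j)
  bel zero    p zero    = p ∷ []
  bel zero    p (suc j) = []
  bel (suc i) p zero    = []
  bel {e = e} (suc i) p (suc j) = bel {e = e ∘ suc} i p j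
  hol : ∀ {n} (i : Fin n) → ↑ (pts i i) t
  hol zero    = here (⊑-refl t)
  hol (suc i) = hol i

Monotone : ∀ {n} → (Env n → Set) → Set₁
Monotone F = ∀ {e e′} → (∀ i → e i ⊆ e′ i) → F e → F e′

-- Concatenating the two finite approximations preserves both properties, by monotonicity.
_⊗_ : ∀ {n} {e : Env n} {F G : Env n → Set} → Monotone F → Monotone G →
      Approx e F → Approx e G → Approx e (λ e′ → F e′ × G e′)
(mF ⊗ mG) (approx p b h) (approx p′ b′ h′) =
  approx (λ i → p i ++ p′ i) (λ i → All.++⁺ (b i) (b′ i))
    (mF (λ i → ++⁺ˡ) h , mG (λ i → ++⁺ʳ (p i)) h′)

mapApprox : ∀ {n} {e : Env n} {F G : Env n → Set} → (∀ {e′} → F e′ → G e′) →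
            Approx e F → Approx e G
mapApprox f (approx p b h) = approx p b (f h)

mutual
  ⟦⟧-continuous : ∀ {n} (M : Term n) t → Continuous (λ e → ⟦ M ⟧ e t)
  ⟦⟧-continuous (var i)   t e p = singleton i p
  ⟦⟧-continuous (lam M)   t e m with ⟦⟧-continuous M (res t) _ m
  ... | approx p b h = approx (p ∘ suc) (b ∘ suc)
    -- The part found for the bound variable lies in `↑ (args t)`, which may replace it.
    (⟦⟧-mono M (λ { zero → ↑-least (↑-upward (args t)) (b zero) ; (suc i) → id }) h)
  ⟦⟧-continuous (app M N) t e (a , m , ns) =
    mapApprox (λ (p , q) → a , p , q)
      (((λ e⊆ → ⟦⟧-mono M e⊆) ⊗ (λ e⊆ → All.map (⟦⟧-mono N e⊆)))
        (⟦⟧-continuous M (a ↦ t) e m) (All-continuous N a e ns))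

  All-continuous : ∀ {n} (N : Term n) a → Continuous (λ e → All (⟦ N ⟧ e) a)
  All-continuous N []      e []       = approx (λ _ → []) (λ _ → []) []
  All-continuous N (t ∷ a) e (n ∷ ns) =
    mapApprox (λ (p , q) → p ∷ q)
      (((λ e⊆ → ⟦⟧-mono N e⊆) ⊗ (λ e⊆ → All.map (⟦⟧-mono N e⊆)))
        (⟦⟧-continuous N t e n) (All-continuous N a e ns))

-- Forwards, a list of elements of `P` generates a subset of `P`. Backwards, continuity says that
-- the body uses only finitely many elements of `P`, and these form the argument list.
⟦β⟧ : ∀ {n} (M : Term (suc n)) {e P} → (∀ i → Upward (e i)) → Upward P →
      ⟦ lam M ⟧ e · P ≐ ⟦ M ⟧ (P ▸ e)
⟦β⟧ M {e} {P} ups up = to , from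
  where
  to : ⟦ lam M ⟧ e · P ⊆ ⟦ M ⟧ (P ▸ e)
  to (a , m , ps) = ⟦⟧-mono M (▸-mono (↑-least up ps) (λ _ → id)) m
  from : ⟦ M ⟧ (P ▸ e) ⊆ ⟦ lam M ⟧ e · P
  from {t} m with ⟦⟧-continuous M t (P ▸ e) m
  ... | approx p b h = p zero ,
    ⟦⟧-mono M (λ { zero → id ; (suc i) → ↑-least (ups i) (b (suc i)) }) h , b zero

-- Every `d`, including `⋆`, is equivalent under `⊑` to `args d ↦ res d`.
⟦η⟧ : ∀ {n} (M : Term n) {e} → (∀ i → Upward (e i)) →
      ⟦ lam (app (weaken M) (var zero)) ⟧ e ≐ ⟦ M ⟧ e
⟦η⟧ M {e} ups = to , from
  where
  to : ⟦ lam (app (weaken M) (var zero)) ⟧ e ⊆ ⟦ M ⟧ e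
  to {d} (a , m , as) =
    ⟦⟧-upward M ups (arr as (⊑-refl (res d))) (proj₁ (⟦rename⟧ suc M _) m)
  from : ⟦ M ⟧ e ⊆ ⟦ lam (app (weaken M) (var zero)) ⟧ e
  from {d} m = args d ,
    proj₂ (⟦rename⟧ suc M _) (⟦⟧-upward M ups (arr (⊆-↑ (args d)) (⊑-refl (res d))) m) ,
    ⊆-↑ (args d)

⟦⟧-⟶ : ∀ {n} {M N : Term n} → M ⟶ N → ∀ {e} → (∀ i → Upward (e i)) → ⟦ M ⟧ e ≐ ⟦ N ⟧ e
⟦⟧-⟶ (β {M} {N}) {e} ups = ≐-trans (⟦β⟧ M ups (⟦⟧-upward N ups))
  (≐-sym (≐-trans (⟦subst⟧ (single N) M e) (⟦⟧-cong M single-env)))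
  where
  single-env : ∀ i → ⟦ single N i ⟧ e ≐ (⟦ N ⟧ e ▸ e) i
  single-env zero    = ≐-refl
  single-env (suc i) = ≐-refl
⟦⟧-⟶ (η {M}) ups = ⟦η⟧ M ups
⟦⟧-⟶ (ξ {M} {M′} r) {e} ups = (λ {d} → proj₁ (eq d)) , (λ {d} → proj₂ (eq d))
  where
  eq : ∀ d → ⟦ M ⟧ (↑ (args d) ▸ e) ≐ ⟦ M′ ⟧ (↑ (args d) ▸ e)
  eq d = ⟦⟧-⟶ r (▸-upward (↑-upward (args d)) ups)
⟦⟧-⟶ (appˡ r) ups = ·-cong (⟦⟧-⟶ r ups) ≐-refl
⟦⟧-⟶ (appʳ {M} r) {e} ups = ·-cong (≐-refl {x = ⟦ M ⟧ e}) (⟦⟧-⟶ r ups)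

⟦⟧-=βη : ∀ {n} {M N : Term n} → M =βη N → ∀ {e} → (∀ i → Upward (e i)) → ⟦ M ⟧ e ≐ ⟦ N ⟧ e
⟦⟧-=βη ε             ups = ≐-refl
⟦⟧-=βη (fwd r ◅ eqs) ups = ≐-trans (⟦⟧-⟶ r ups) (⟦⟧-=βη eqs ups)
⟦⟧-=βη (bwd r ◅ eqs) ups = ≐-trans (≐-sym (⟦⟧-⟶ r ups)) (⟦⟧-=βη eqs ups)

-- The full type hierarchy over two points, coded in `Fin`.

card : Type → ℕ
card o       = 2
card (σ ⇒ τ) = card τ ^ card σ

-- A record, so that σ can be inferred from Val σ although card is not injective.
record Val (σ : Type) : Set where
  constructor val
  field code : Fin (card σ)
open Val

infixl 8 _⊙_

_⊙_ : ∀ {σ τ} → Val (σ ⇒ τ) → Val σ → Val τ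
_⊙_ {σ} {τ} d x = val (finToFun {card τ} {card σ} (code d) (code x))

Λ : ∀ {σ τ} → (Val σ → Val τ) → Val (σ ⇒ τ)
Λ f = val (funToFin (λ i → code (f (val i))))

Λ-⊙ : ∀ {σ τ} (f : Val σ → Val τ) x → Λ f ⊙ x ≡ f x
Λ-⊙ f x = ≡.cong val (finToFun-funToFin (λ i → code (f (val i))) (code x))

ValEnv : ∀ {n} → Vec Type n → Set
ValEnv Γ = ∀ i → Val (Vec.lookup Γ i)

infixr 5 _▹_

_▹_ : ∀ {n σ} {Γ : Vec Type n} → Val σ → ValEnv Γ → ValEnv (σ ∷ Γ)
(x ▹ v) zero    = x
(x ▹ v) (suc i) = v i

eval : ∀ {n} {Γ : Vec Type n} {M τ} → Γ ⊢ M ∶ τ → ValEnv Γ → Val τ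
eval (⊢var {i}) v = v i
eval (⊢lam M)   v = Λ λ x → eval M (x ▹ v)
eval (⊢app M N) v = eval M v ⊙ eval N v

-- The logical relation between the two models.

-- ∅ and U absorb application to any argument, so they represent the two constant
-- values at every type.
truth : Fin 2 → Pred D 0ℓ
truth zero       = ∅
truth (suc zero) = U

-- Only upward closed arguments are tested, because `⟦β⟧` holds for those.
Represents : ∀ σ → Pred D 0ℓ → Val σ → Set₁
Represents o       P d = Lift _ (P ≐ truth (code d))
Represents (σ ⇒ τ) P d = ∀ Q x → Upward Q → Represents σ Q x → Represents τ (P · Q) (d ⊙ x)

Represents-resp : ∀ σ {P P′ d d′} → P ≐ P′ → d ≡ d′ → Represents σ P d → Represents σ P′ d′
Represents-resp o       P≐ refl (lift r)  = lift (≐-trans (≐-sym P≐) r)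
Represents-resp (σ ⇒ τ) P≐ refl r Q x up q =
  Represents-resp τ (·-cong P≐ ≐-refl) refl (r Q x up q)

-- The fundamental lemma of the logical relation. For an abstraction, `⟦β⟧` and `Λ-⊙` contract the
-- applied function on the two sides.
eval-sound : ∀ {n} {Γ : Vec Type n} {M τ} (⊢M : Γ ⊢ M ∶ τ) {e : Env n} {v : ValEnv Γ} →
             (∀ i → Upward (e i)) → (∀ i → Represents (Vec.lookup Γ i) (e i) (v i)) →
             Represents τ (⟦ M ⟧ e) (eval ⊢M v)
eval-sound (⊢var {i}) ups rs = rs i
eval-sound {Γ = Γ} (⊢lam {M} {σ} {τ} ⊢M) {e} {v} ups rs Q x up q =
  Represents-resp τ (≐-sym (⟦β⟧ M ups up)) (≡.sym (Λ-⊙ (λ y → eval ⊢M (y ▹ v)) x))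
    (eval-sound ⊢M (▸-upward up ups) extended)
  where
  extended : ∀ i → Represents (Vec.lookup (σ ∷ Γ) i) ((Q ▸ e) i) ((x ▹ v) i)
  extended zero    = q
  extended (suc i) = rs i
eval-sound (⊢app {N = N} ⊢M ⊢N) ups rs =
  eval-sound ⊢M ups rs _ _ (⟦⟧-upward N ups) (eval-sound ⊢N ups rs)

-- Church numerals in both models.

successor : ∀ {τ} → Val (ω τ) → Val (ω τ)
successor d = Λ λ f → Λ λ x → f ⊙ (d ⊙ f ⊙ x)

-- Iterating `successor`, instead of evaluating `ρ m`, makes the sequence visibly an orbit of one
-- self-map.
numeral : ∀ {τ} → ℕ → Val (ω τ)
numeral zero    = Λ λ f → Λ λ x → x
numeral (suc m) = successor (numeral m)

Λ-⊙₂ : ∀ {σ₁ σ₂ τ} (f : Val σ₁ → Val σ₂ → Val τ) x y → (Λ λ x → Λ λ y → f x y) ⊙ x ⊙ y ≡ f x y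
Λ-⊙₂ f x y = ≡.trans (≡.cong (_⊙ y) (Λ-⊙ (λ x → Λ (f x)) x)) (Λ-⊙ (f x) y)

iterate : ℕ → Pred D 0ℓ → Pred D 0ℓ → Pred D 0ℓ
iterate zero    F X = X
iterate (suc m) F X = F · iterate m F X

iterate-upward : ∀ m {F X} → Upward F → Upward X → Upward (iterate m F X)
iterate-upward zero        upF upX = upX
iterate-upward (suc m) {F} upF upX = ·-upward {P = F} upF

iterate-represents : ∀ {τ F X f x} m → Upward F → Upward X →
  Represents (τ ⇒ τ) F f → Represents τ X x →
  Represents τ (iterate m F X) (numeral m ⊙ f ⊙ x)
iterate-represents {τ} {f = f} {x} zero upF upX rF rX =
  Represents-resp τ ≐-refl (≡.sym (Λ-⊙₂ (λ _ y → y) f x)) rX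
iterate-represents {τ} {F} {X} {f} {x} (suc m) upF upX rF rX =
  Represents-resp τ (≐-refl {x = F · iterate m F X})
    (≡.sym (Λ-⊙₂ (λ g y → g ⊙ (numeral m ⊙ g ⊙ y)) f x))
    (rF _ _ (iterate-upward m upF upX) (iterate-represents m upF upX rF rX))

module _ {e : Env 0} where

  no-vars : ∀ i → Upward (e i)
  no-vars ()

  ⟦ρ⟧ : ∀ m {F X} → Upward F → Upward X → ⟦ ρ m ⟧ e · F · X ≐ iterate m F X
  ⟦ρ⟧ m {F} {X} upF upX =
    ≐-trans (·-cong (⟦β⟧ (lam (iterApp m (var (suc zero)) (var zero))) no-vars upF) ≐-refl)
      (≐-trans (⟦β⟧ (iterApp m (var (suc zero)) (var zero)) (▸-upward upF no-vars) upX) (body m))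
    where
    body : ∀ m → ⟦ iterApp m (var (suc zero)) (var zero) ⟧ (X ▸ F ▸ e) ≐ iterate m F X
    body zero    = ≐-refl
    body (suc m) = ·-cong (≐-refl {x = F}) (body m)

  numeral-represents : ∀ τ m → Represents (ω τ) (⟦ ρ m ⟧ e) (numeral m)
  numeral-represents τ m F f upF rF X x upX rX =
    Represents-resp τ (≐-sym (⟦ρ⟧ m upF upX)) refl (iterate-represents m upF upX rF rX)

-- Separating the numerals of 0 and 1.

truth-upward : ∀ b → Upward (truth b)
truth-upward (suc zero) _ _ = tt

truth-· : ∀ b {Q} → truth b · Q ≐ truth b
truth-· zero       = (λ (_ , m , _) → m) , λ ()
truth-· (suc zero) = (λ _ → tt) , λ _ → [] , tt , []

constant : ∀ τ → Fin 2 → Val τ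
constant o       b = val b
constant (σ ⇒ τ) b = Λ λ _ → constant τ b

truth-represents : ∀ τ b → Represents τ (truth b) (constant τ b)
truth-represents o       b = lift ≐-refl
truth-represents (σ ⇒ τ) b Q x _ _ =
  Represents-resp τ (≐-sym (truth-· b)) (≡.sym (Λ-⊙ (λ _ → constant τ b) x))
    (truth-represents τ b)

-- At an arrow type both sets are applied to the same represented argument; they absorb it, and the
-- type gets smaller until `o`, where `∅` and `U` differ.
∅-U-separated : ∀ τ d → Represents τ ∅ d → Represents τ U d → ⊥
∅-U-separated o       d (lift r) (lift s) = proj₂ r {⋆} (proj₁ s {⋆} tt)
∅-U-separated (σ ⇒ τ) d r s =
  ∅-U-separated τ (d ⊙ constant σ zero)
    (Represents-resp τ (truth-· zero {truth zero}) refl (r _ _ (truth-upward zero) (truth-represents σ zero)))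
    (Represents-resp τ (truth-· (suc zero) {truth zero}) refl (s _ _ (truth-upward zero) (truth-represents σ zero)))

-- With function `U` and argument `∅`, no iteration leaves `∅`, while one iteration gives `U`.
ρ0-ρ1-separated : ∀ {e} τ d → Represents (ω τ) (⟦ ρ 0 ⟧ e) d → Represents (ω τ) (⟦ ρ 1 ⟧ e) d → ⊥
ρ0-ρ1-separated {e} τ d r s =
  ∅-U-separated τ (d ⊙ constant (τ ⇒ τ) (suc zero) ⊙ constant τ zero)
    (Represents-resp τ (⟦ρ⟧ {e} 0 upU up∅) refl (r U _ upU rU ∅ _ up∅ r∅))
    (Represents-resp τ (≐-trans (⟦ρ⟧ {e} 1 upU up∅) (truth-· (suc zero) {∅})) refl (s U _ upU rU ∅ _ up∅ r∅))
  where
  upU : Upward U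
  upU = truth-upward (suc zero)
  up∅ : Upward ∅
  up∅ = truth-upward zero
  rU = truth-represents (τ ⇒ τ) (suc zero)
  r∅ = truth-represents τ zero

-- Eventually periodic sequences.

module _ {X : Set} (x : ℕ → X) where

  Periodic : (N P : ℕ) → Set
  Periodic N P = ∀ n → x (n + (P + N)) ≡ x (n + N)

  Periodic-* : ∀ {N P} → Periodic N P → ∀ k n → x (n + k * P + N) ≡ x (n + N)
  Periodic-* {N} per zero    n = ≡.cong (λ y → x (y + N)) (ℕ.+-identityʳ n)
  Periodic-* {N} {P} per (suc k) n = ≡.trans (≡.cong x (regroup n (k * P) P N))
    (≡.trans (per (n + k * P)) (Periodic-* per k n))
    where
    regroup : ∀ n kP P N → n + (P + kP) + N ≡ n + kP + (P + N)
    regroup = solve-∀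

  -- The period is doubled because f₁ˡ is available only for l ≥ 2.
  Periodic⇒% : ∀ {N p} → Periodic N (suc p) → let l = suc p + suc p in
               ∀ n → x (n + N * l) ≡ x (n % l + N * l)
  Periodic⇒% {N} {p} per n with ℕ.m≤n⇒∃[o]m+o≡n (ℕ.m≤m*n N (suc p + suc p))
  ... | j , N+j≡N*l = begin
    x (n + N * l)                       ≡⟨ ≡.cong₂ (λ y z → x (y + z)) (m≡m%n+[m/n]*n n l) (≡.sym N+j≡N*l) ⟩
    x (r + q * (suc p + suc p) + (N + j)) ≡⟨ ≡.cong x (regroup r q (suc p) N j) ⟩
    x ((r + j) + (q + q) * suc p + N)   ≡⟨ Periodic-* per (q + q) (r + j) ⟩
    x (r + j + N)                       ≡⟨ ≡.cong x (≡.trans (ℕ.+-assoc r j N) (≡.cong (r +_) (≡.trans (ℕ.+-comm j N) N+j≡N*l))) ⟩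
    x (r + N * l)                       ∎
    where
    open ≡.≡-Reasoning
    l = suc p + suc p
    r = n % l
    q = n / l
    regroup : ∀ r q P N j → r + q * (P + P) + (N + j) ≡ (r + j) + (q + q) * P + N
    regroup = solve-∀

-- Two of the first `k + 1` terms coincide, and `s` carries the coincidence to all later terms.
orbit-periodic : ∀ {k} (s : Fin k → Fin k) (x : ℕ → Fin k) → (∀ n → x (suc n) ≡ s (x n)) →
                 ∃₂ λ N p → Periodic x N (suc p)
orbit-periodic {k} s x step with pigeonhole (ℕ.n<1+n k) (x ∘ toℕ)
... | i , j , i<j , xi≡xj with ℕ.m≤n⇒∃[o]m+o≡n i<j
... | p , i+p≡j = toℕ i , p , periodic
  where
  periodic : Periodic x (toℕ i) (suc p)
  periodic zero    = ≡.trans (≡.cong x (≡.trans (≡.cong suc (ℕ.+-comm p (toℕ i))) i+p≡j)) (≡.sym xi≡xj)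
  periodic (suc n) = ≡.trans (step _) (≡.trans (≡.cong s (periodic n)) (≡.sym (step _)))

numeral-periodic : ∀ τ → ∃₂ λ N p → Periodic (numeral {τ}) N (suc p)
numeral-periodic τ
  with N , p , per ← orbit-periodic (code ∘ successor {τ} ∘ val) (code ∘ numeral {τ}) (λ _ → refl)
  = N , p , λ n → ≡.cong val (per n)

-- Periodic case distinctions as members of `𝒢`.

𝒢-proj : ∀ {k} (i : Fin k) → 𝒢 (λ ns → Vec.lookup ns i)
𝒢-proj i = base (isExtPoly (base (isProj i)))

-- Threshold 0 is not among the generators `f₂`, but there `ifzero` does the same.
𝒢-f₂ : ∀ l → 𝒢 (f₂ l)
𝒢-f₂ (suc l) = base (isF₂ (suc l) (s≤s z≤n))
𝒢-f₂ zero    = resp ifzero≗f₂ (base (isExtPoly (base isIfzero)))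
  where
  ifzero≗f₂ : ∀ ns → ifzero ns ≡ f₂ 0 ns
  ifzero≗f₂ (zero  ∷ _ ∷ _ ∷ []) = refl
  ifzero≗f₂ (suc _ ∷ _ ∷ _ ∷ []) = refl

module _ {f : Op 3} where

  at : ℕ → ℕ → ℕ → ℕ
  at m n₁ n₂ = f (m ∷ n₁ ∷ n₂ ∷ [])

  Selects : ℕ → Fin 2 → Set
  Selects m i = ∀ n₁ n₂ → at m n₁ n₂ ≡ Vec.lookup (n₁ ∷ n₂ ∷ []) i

  AgreesFrom : ℕ → Op 3 → Set
  AgreesFrom k h = ∀ m n₁ n₂ → k ≤ m → h (m ∷ n₁ ∷ n₂ ∷ []) ≡ at m n₁ n₂

  module _ (side : ∀ m → ∃ (Selects m)) where

    proj : ℕ → Op 3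
    proj m ns = Vec.lookup ns (suc (proj₁ (side m)))

    -- For `m ≥ k` the test `m ≤ k` of `f₂ k` singles out `m = k`, where `f` is a fixed projection;
    -- beyond `k` the old `h` serves.
    lower-threshold : ∀ k {h} → 𝒢 h → AgreesFrom (suc k) h → ∃ λ h′ → 𝒢 h′ × AgreesFrom k h′
    lower-threshold k {h} 𝒢h agree = _ , comp {hs = hs} (𝒢-f₂ k) 𝒢hs , agree′
      where
      hs : Fin 3 → Op 3
      hs zero             ns = Vec.lookup ns zero
      hs (suc zero)       = proj k
      hs (suc (suc zero)) = h
      𝒢hs : ∀ i → 𝒢 (hs i)
      𝒢hs zero             = 𝒢-proj zero
      𝒢hs (suc zero)       = 𝒢-proj (suc (proj₁ (side k)))
      𝒢hs (suc (suc zero)) = 𝒢h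
      agree′ : AgreesFrom k (λ ns → f₂ k (Vec.tabulate (λ i → hs i ns)))
      agree′ m n₁ n₂ k≤m with m ≤ᵇ k | ℕ.≤ᵇ-reflects-≤ m k
      ... | true  | ofʸ m≤k with refl ← ℕ.≤-antisym k≤m m≤k = ≡.sym (proj₂ (side k) n₁ n₂)
      ... | false | ofⁿ m≰k = agree m n₁ n₂ (ℕ.≰⇒> m≰k)

    AgreesFrom⇒𝒢 : ∀ k {h} → 𝒢 h → AgreesFrom k h → 𝒢 f
    AgreesFrom⇒𝒢 zero    𝒢h agree = resp (λ { (m ∷ n₁ ∷ n₂ ∷ []) → agree m n₁ n₂ z≤n }) 𝒢h
    AgreesFrom⇒𝒢 (suc k) 𝒢h agree with lower-threshold k 𝒢h agree
    ... | _ , 𝒢h′ , agree′ = AgreesFrom⇒𝒢 k 𝒢h′ agree′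

    -- `f₁ l` picks one projection per residue, which settles all large `m`; the finitely many
    -- smaller ones are corrected by thresholds. The periodic part starts at a multiple of `l`, so
    -- the shift by `N * l` keeps residues.
    eventually-periodic⇒𝒢 : ∀ l .{{_ : NonZero l}} → 2 ≤ l → ∀ N →
      (∀ n n₁ n₂ → at (n + N * l) n₁ n₂ ≡ at (n % l + N * l) n₁ n₂) → 𝒢 f
    eventually-periodic⇒𝒢 l 2≤l N per =
      AgreesFrom⇒𝒢 (N * l) (comp {hs = hs} (base (isF₁ l 2≤l)) 𝒢hs) agree
      where
      hs : Fin (suc l) → Op 3
      hs zero    ns = Vec.lookup ns zero
      hs (suc r) = proj (toℕ r + N * l)
      𝒢hs : ∀ i → 𝒢 (hs i)
      𝒢hs zero    = 𝒢-proj zero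
      𝒢hs (suc r) = 𝒢-proj (suc (proj₁ (side (toℕ r + N * l))))
      agree : AgreesFrom (N * l) (λ ns → f₁ l (Vec.tabulate (λ i → hs i ns)))
      agree m n₁ n₂ N*l≤m with ℕ.m≤n⇒∃[o]m+o≡n N*l≤m
      ... | n , refl = begin
        Vec.lookup (Vec.tabulate (λ r → hs (suc r) ns)) (m mod l)
          ≡⟨ lookup∘tabulate (λ r → hs (suc r) ns) (m mod l) ⟩
        proj (toℕ (m mod l) + N * l) ns
          ≡⟨ ≡.sym (proj₂ (side (toℕ (m mod l) + N * l)) n₁ n₂) ⟩
        at (toℕ (m mod l) + N * l) n₁ n₂
          ≡⟨ ≡.cong (λ r → at (r + N * l) n₁ n₂) (≡.trans (toℕ-fromℕ< (m%n<n m l)) m%l≡n%l) ⟩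
        at (n % l + N * l) n₁ n₂
          ≡⟨ ≡.sym (per n n₁ n₂) ⟩
        at (n + N * l) n₁ n₂
          ≡⟨ ≡.cong (λ y → at y n₁ n₂) (ℕ.+-comm n (N * l)) ⟩
        at m n₁ n₂ ∎
        where
        open ≡.≡-Reasoning
        ns : Vec ℕ 3
        ns = m ∷ n₁ ∷ n₂ ∷ []
        m%l≡n%l : m % l ≡ n % l
        m%l≡n%l = ≡.trans (≡.cong (_% l) (ℕ.+-comm (N * l) n)) ([m+kn]%n≡m%n n N l)

    -- With 1 and 0 as the two choices, the output numeral reveals the side. Equal values of the
    -- inputs give equal output values, so different sides would make one value represent both `ρ 0`
    -- and `ρ 1`.
    numeral-determines : ∀ {τ E} → [] ⊢ E ∶ ωFun 3 τ →
      (∀ ns → appAll E (Vec.map ρ ns) =βη ρ (f ns)) →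
      ∀ m m′ → numeral {τ} m ≡ numeral m′ → ∀ n₁ n₂ → at m n₁ n₂ ≡ at m′ n₁ n₂
    numeral-determines {τ} {E} ⊢E E-defines m m′ m≡m′ n₁ n₂ = cases (side m) (side m′)
      where
      e : Env 0
      e ()

      output : Val (ω τ) → Val (ω τ)
      output d = eval ⊢E (λ ()) ⊙ d ⊙ numeral 1 ⊙ numeral 0

      ρ-upward : ∀ k → Upward (⟦ ρ k ⟧ e)
      ρ-upward k = ⟦⟧-upward (ρ k) λ ()

      output-represents : ∀ m b → at m 1 0 ≡ b →
                          Represents (ω τ) (⟦ ρ b ⟧ e) (output (numeral m))
      output-represents m _ refl =
        Represents-resp (ω τ) {d = output (numeral m)} (⟦⟧-=βη (E-defines (m ∷ 1 ∷ 0 ∷ [])) λ ()) refl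
          (eval-sound ⊢E {e} (λ ()) (λ ())
            (⟦ ρ m ⟧ e) (numeral m) (ρ-upward m) (numeral-represents {e} τ m)
            (⟦ ρ 1 ⟧ e) (numeral 1) (ρ-upward 1) (numeral-represents {e} τ 1)
            (⟦ ρ 0 ⟧ e) (numeral 0) (ρ-upward 0) (numeral-represents {e} τ 0))

      different : ∀ m m′ → numeral {τ} m ≡ numeral m′ → at m 1 0 ≡ 0 → at m′ 1 0 ≡ 1 → ⊥
      different m m′ m≡m′ p p′ = ρ0-ρ1-separated {e} τ (output (numeral m)) (output-represents m 0 p)
        (≡.subst (λ d → Represents (ω τ) (⟦ ρ 1 ⟧ e) (output d)) (≡.sym m≡m′)
          (output-represents m′ 1 p′))

      cases : ∃ (Selects m) → ∃ (Selects m′) → at m n₁ n₂ ≡ at m′ n₁ n₂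
      cases (zero     , s) (zero     , s′) = ≡.trans (s n₁ n₂) (≡.sym (s′ n₁ n₂))
      cases (suc zero , s) (suc zero , s′) = ≡.trans (s n₁ n₂) (≡.sym (s′ n₁ n₂))
      cases (zero     , s) (suc zero , s′) = ⊥-elim (different m′ m (≡.sym m≡m′) (s′ 1 0) (s 1 0))
      cases (suc zero , s) (zero     , s′) = ⊥-elim (different m m′ m≡m′ (s 1 0) (s′ 1 0))

    definable⇒𝒢 : StrictlyDefinable f → 𝒢 f
    definable⇒𝒢 (τ , E , ⊢E , E-defines) with numeral-periodic τ
    ... | N , p , per = eventually-periodic⇒𝒢 l (s≤s (ℕ.m≤n⇒m≤o+n p (s≤s z≤n))) N
      λ n → numeral-determines ⊢E E-defines (n + N * l) (n % l + N * l) (Periodic⇒% numeral per n)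
      where
      l = suc p + suc p

-- Case functions and the final dichotomy.

open IsCaseFunction

-- Membership in `A` need not be decidable, but the number `f(m,1,0)` reveals the side. Equality on
-- `ℕ` is stable, so the proof may use excluded middle for `m ∈ A` under a double negation.
case-selects : ∀ {a} {A : Pred ℕ a} {f} → IsCaseFunction A f → ∀ m → ∃ (Selects {f} m)
case-selects {A = A} {f} isCase m with at {f} m 1 0 in eq
... | zero = suc zero , λ n₁ n₂ → decidable-stable (_ ≟ _) λ ≢n₂ → ¬¬-excluded-middle λ where
  (yes m∈A) → contradiction (≡.trans (≡.sym (inside isCase m 1 0 m∈A)) eq) λ ()
  (no  m∉A) → ≢n₂ (outside isCase m n₁ n₂ m∉A)
... | suc _ = zero , λ n₁ n₂ → decidable-stable (_ ≟ _) λ ≢n₁ → ¬¬-excluded-middle λ where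
  (yes m∈A) → ≢n₁ (inside isCase m n₁ n₂ m∈A)
  (no  m∉A) → contradiction (≡.trans (≡.sym (outside isCase m 1 0 m∉A)) eq) λ ()

-- The implication is constructive; excluded middle enters only to decide `StrictlyDefinable f` for
-- the disjunction.
theorem3 : ∀ {a} (A : Pred ℕ a) (f : Op 3) → IsCaseFunction A f →
    (StrictlyDefinable f → 𝒢 f) ×
    (ExcludedMiddle 0ℓ → (¬ StrictlyDefinable f) ⊎ 𝒢 f)
theorem3 A f isCase = definable⇒𝒢f , λ em → dichotomy (em {StrictlyDefinable f})
  where
  definable⇒𝒢f : StrictlyDefinable f → 𝒢 f
  definable⇒𝒢f = definable⇒𝒢 (case-selects isCase)
  dichotomy : Dec (StrictlyDefinable f) → (¬ StrictlyDefinable f) ⊎ 𝒢 f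
  dichotomy (yes d) = inj₂ (definable⇒𝒢f d)
  dichotomy (no ¬d) = inj₁ ¬d
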